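{- Let $m$ be a partial assignment and $f$ a formula such that the state $m \parallel f$ is well-formed (i.e. $m$ is well-formed in $f$). If $m \parallel f$ is a final state of the classical DPLL transition system, then $m$ is a model of $f$.
   Context: Fix a finite set $P$ of atoms. A literal is an atom $p\in P$ or its negation $\neg p$, with $\neg\neg p=p$. A clause is a finite list of literals, read as their disjunction; a formula (CNF) is a finite list of clauses, read as their conjunction. A partial assignment is an arbitrary finite list of literals, each annotated either as a decision literal (written $l^d$) or as a propagated literal (written $l$). New literals are appended on the right, and $mn$ denotes concatenation. Evaluation takes values in $\{T,F,U\}$ and ignores annotations; the rightmost occurrence of an atom takes precedence: $[\![l]\!]_m=T$ if the rightmost occurrence in $m$ of the atom of $l$ is as $l$, $F$ if it is as $\neg l$, and $U$ if the atom does not occur in $m$. For a clause $c$: $[\![c]\!]_m=T$ if some literal of $c$ evaluates to $T$, $F$ if all literals of $c$ evaluate to $F$, else $U$. For a formula $f$: $[\![f]\!]_m=T$ if all clauses evaluate to $T$, $F$ if some clause evaluates to $F$, else $U$. "True/false/undefined in $m$" means value $T/F/U$. $m$ satisfies $f$ (is a model of $f$) if $[\![f]\!]_m=T$. $m$ is well-formed in $f$ if it is duplicate-free (each atom occurs at most once in $m$) and bounded by $f$ (the atom of every literal of $m$ occurs in $f$). A state is either the distinguished state $\mathtt{fail}$ or a pair $m\parallel f$ of a partial assignment and a formula. The classical DPLL system is the relation $\Longrightarrow$ on states given by the rules (order within clauses and formulas being irrelevant for reading $c\lor l$, $f\land c$): UnitPropagate: $m\parallel f\land(c\lor l)\Longrightarrow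 m\,l\parallel f\land(c\lor l)$ if $c$ is false in $m$ and $l$ is undefined in $m$. Decide: $m\parallel f\Longrightarrow m\,l^d\parallel f$ if $l$ or $\neg l$ occurs in a clause of $f$ and $l$ is undefined in $m$. Fail: $m\parallel f\land c\Longrightarrow\mathtt{fail}$ if $c$ is false in $m$ and $m$ contains no decision literals. Backtrack: $m\,l^d\,n\parallel f\land c\Longrightarrow m\,\neg l\parallel f\land c$ if $c$ is false in $m\,l^d\,n$ and $n$ contains no decision literals (the new $\neg l$ is propagated). Pure: $m\parallel f\Longrightarrow m\,l\parallel f$ if $l$ occurs in a clause of $f$, $\neg l$ occurs in no clause of $f$, and $l$ is undefined in $m$. A state $s$ is final if there is no $s'$ with $s\Longrightarrow s'$. -}

module Defs where

open import Level using (Level)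
open import Data.Nat.Base using (ℕ)
open import Data.Fin.Base using (Fin)
open import Data.Fin.Properties using (inj⇒≟)
open import Data.Bool.Base using (if_then_else_)
open import Data.List.Base using (List; []; _∷_; _++_; _∷ʳ_; map)
open import Data.List.Membership.Propositional using (_∈_)
open import Data.List.Relation.Unary.All using (All; all?)
open import Data.List.Relation.Unary.Any using (Any; any?)
open import Data.List.Relation.Unary.Unique.Propositional using (Unique)
open import Data.List.Relation.Binary.Permutation.Propositional using (_↭_)
open import Data.Product.Base using (_×_; ∃)
open import Data.Sum.Base using (_⊎_)
open import Function.Base using (_∘_)
open import Function.Bundles using (_↔_)
open import Function.Properties.Inverse using (↔⇒↣)
open import Relation.Binary.Definitions using (DecidableEquality)
open import Relation.Binary.PropositionalEquality.Core using (_≡_; refl; cong)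
open import Relation.Nullary using (¬_; yes; no; does)
open import Relation.Nullary.Decidable using (map′)

data Value : Set where
  T F U : Value

infix 4 _≟ᵛ_

_≟ᵛ_ : DecidableEquality Value
T ≟ᵛ T = yes refl
T ≟ᵛ F = no λ ()
T ≟ᵛ U = no λ ()
F ≟ᵛ T = no λ ()
F ≟ᵛ F = yes refl
F ≟ᵛ U = no λ ()
U ≟ᵛ T = no λ ()
U ≟ᵛ F = no λ ()
U ≟ᵛ U = yes refl

-- P is the finite set of atoms; finiteness also supplies decidable equality.
module DPLL {a : Level} {P : Set a} {k : ℕ} (P-finite : P ↔ Fin k) where

  infix 8 ~_
  infix 4 _≟_ _≟ˡ_ _∥_ _⊨_ _OccursIn_ _AtomOccursIn_ _BoundedBy_ _WellFormedIn_
  infix 3 _⟹_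
  infixr 5 _orElse_

  _≟_ : DecidableEquality P
  _≟_ = inj⇒≟ (↔⇒↣ P-finite)

  data Literal : Set a where
    pos neg : P → Literal

  atom : Literal → P
  atom (pos p) = p
  atom (neg p) = p

  ~_ : Literal → Literal
  ~ pos p = neg p
  ~ neg p = pos p

  _≟ˡ_ : DecidableEquality Literal
  pos p ≟ˡ pos q = map′ (cong pos) (λ { refl → refl }) (p ≟ q)
  pos p ≟ˡ neg q = no λ ()
  neg p ≟ˡ pos q = no λ ()
  neg p ≟ˡ neg q = map′ (cong neg) (λ { refl → refl }) (p ≟ q)

  Clause : Set a
  Clause = List Literal

  Formula : Set a
  Formula = List Clause

  data AnnotatedLiteral : Set a where
    decision propagated : Literal → AnnotatedLiteral

  literal : AnnotatedLiteral → Literal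
  literal (decision l)   = l
  literal (propagated l) = l

  data IsDecision : AnnotatedLiteral → Set a where
    isDecision : ∀ {l} → IsDecision (decision l)

  -- The last element of the list is the most recently added literal.
  PartialAssignment : Set a
  PartialAssignment = List AnnotatedLiteral

  NoDecisions : PartialAssignment → Set a
  NoDecisions m = ¬ Any IsDecision m

  -- The value of l given by the single entry k.
  ⟦_⟧₁ : Literal → Literal → Value
  ⟦ l ⟧₁ k = if does (k ≟ˡ l) then T else if does (k ≟ˡ ~ l) then F else U

  _orElse_ : Value → Value → Value
  T orElse _ = T
  F orElse _ = F
  U orElse v = v

  -- The tail is consulted first, so the rightmost occurrence takes precedence.
  ⟦_⟧ˡ : Literal → PartialAssignment → Value
  ⟦ l ⟧ˡ []      = U
  ⟦ l ⟧ˡ (k ∷ m) = ⟦ l ⟧ˡ m orElse ⟦ l ⟧₁ (literal k)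

  ⟦_⟧ᶜ : Clause → PartialAssignment → Value
  ⟦ c ⟧ᶜ m =
    if does (any? (λ l → ⟦ l ⟧ˡ m ≟ᵛ T) c) then T else
    if does (all? (λ l → ⟦ l ⟧ˡ m ≟ᵛ F) c) then F else U

  ⟦_⟧ᶠ : Formula → PartialAssignment → Value
  ⟦ f ⟧ᶠ m =
    if does (all? (λ c → ⟦ c ⟧ᶜ m ≟ᵛ T) f) then T else
    if does (any? (λ c → ⟦ c ⟧ᶜ m ≟ᵛ F) f) then F else U

  _⊨_ : PartialAssignment → Formula → Set
  m ⊨ f = ⟦ f ⟧ᶠ m ≡ T

  _OccursIn_ : Literal → Formula → Set a
  l OccursIn f = Any (l ∈_) f

  _AtomOccursIn_ : P → Formula → Set a
  p AtomOccursIn f = Any (λ c → p ∈ map atom c) f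

  DuplicateFree : PartialAssignment → Set a
  DuplicateFree m = Unique (map (atom ∘ literal) m)

  _BoundedBy_ : PartialAssignment → Formula → Set a
  m BoundedBy f = All (λ k → atom (literal k) AtomOccursIn f) m

  _WellFormedIn_ : PartialAssignment → Formula → Set a
  m WellFormedIn f = DuplicateFree m × m BoundedBy f

  data State : Set a where
    fail : State
    _∥_  : PartialAssignment → Formula → State

  -- Reading a formula as f′ ∧ c, or a clause as c ∨ l, is up to permutation.
  data _⟹_ : State → State → Set a where

    unitPropagate : ∀ {m f f′ c′ c l} →
      f ↭ c′ ∷ f′ → c′ ↭ l ∷ c →
      ⟦ c ⟧ᶜ m ≡ F → ⟦ l ⟧ˡ m ≡ U →
      m ∥ f ⟹ m ∷ʳ propagated l ∥ f

    decide : ∀ {m f l} →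
      l OccursIn f ⊎ (~ l) OccursIn f → ⟦ l ⟧ˡ m ≡ U →
      m ∥ f ⟹ m ∷ʳ decision l ∥ f

    failure : ∀ {m f f′ c} →
      f ↭ c ∷ f′ →
      ⟦ c ⟧ᶜ m ≡ F → NoDecisions m →
      m ∥ f ⟹ fail

    backtrack : ∀ {m l n f f′ c} →
      f ↭ c ∷ f′ →
      ⟦ c ⟧ᶜ (m ++ decision l ∷ n) ≡ F → NoDecisions n →
      m ++ decision l ∷ n ∥ f ⟹ m ∷ʳ propagated (~ l) ∥ f

    pure : ∀ {m f l} →
      l OccursIn f → ¬ ((~ l) OccursIn f) → ⟦ l ⟧ˡ m ≡ U →
      m ∥ f ⟹ m ∷ʳ propagated l ∥ f

  Final : State → Set a
  Final s = ¬ ∃ λ s′ → s ⟹ s′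

{-# OPTIONS --safe #-}

-- In a final state Decide does not apply, so every literal of f is defined and
-- every clause is true or false. A false clause would allow Fail or Backtrack,
-- according to whether m contains a decision literal; hence all clauses are true.
module Submission where

open import Defs
open import Level using (Level)
open import Data.Nat.Base using (ℕ)
open import Data.Fin.Base using (Fin)
open import Data.Empty using (⊥-elim)
open import Data.List.Base using ([]; _∷_; _++_)
open import Data.List.Membership.Propositional using (_∈_; lose)
open import Data.List.Membership.Propositional.Properties using (∈-∃++)
open import Data.List.Relation.Binary.Permutation.Propositional using (_↭_)
open import Data.List.Relation.Binary.Permutation.Propositional.Properties using (shift)
open import Data.List.Relation.Unary.All as All using (All; all?)
open import Data.List.Relation.Unary.Any using (there; any?)
open import Data.Product.Base using (∃; _×_; _,_)
open import Data.Sum.Base using (_⊎_; inj₁; inj₂)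
open import Function.Bundles using (_↔_)
open import Relation.Binary.PropositionalEquality.Core using (_≡_; _≢_; refl)
open import Relation.Nullary using (yes; no)

-- Turns membership of a clause in the formula into the permutation premise of `failure` and
-- `backtrack`.
∈⇒↭∷ : ∀ {a} {A : Set a} {x : A} {xs} → x ∈ xs → ∃ λ ys → xs ↭ x ∷ ys
∈⇒↭∷ {x = x} x∈xs with ys , zs , refl ← ∈-∃++ x∈xs = ys ++ zs , shift x ys zs

≢T∧≢U⇒≡F : ∀ {v} → v ≢ T → v ≢ U → v ≡ F
≢T∧≢U⇒≡F {T} v≢T _   = ⊥-elim (v≢T refl)
≢T∧≢U⇒≡F {F} _   _   = refl
≢T∧≢U⇒≡F {U} _   v≢U = ⊥-elim (v≢U refl)

module _ {a : Level} {P : Set a} {k : ℕ} (P-finite : P ↔ Fin k) where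
  open DPLL P-finite

  -- The two alternatives match the side conditions of `failure` and `backtrack`. The recursion
  -- inspects the tail first, so the split is at the rightmost decision.
  lastDecision : ∀ m → NoDecisions m ⊎
    ∃ λ m′ → ∃ λ l → ∃ λ n → m ≡ m′ ++ decision l ∷ n × NoDecisions n
  lastDecision [] = inj₁ λ ()
  lastDecision (x ∷ m) with lastDecision m
  ... | inj₂ (m′ , l , n , refl , nd) = inj₂ (x ∷ m′ , l , n , refl , nd)
  lastDecision (decision l ∷ m)   | inj₁ nd = inj₂ ([] , l , m , refl , nd)
  lastDecision (propagated l ∷ m) | inj₁ nd = inj₁ λ { (there d) → nd d }

  -- A clause evaluates to `U` only if no literal is true and not all are false, so some literal
  -- would have to be undefined.
  defined⇒clauseTrue : ∀ m c → All (λ l → ⟦ l ⟧ˡ m ≢ U) c → ⟦ c ⟧ᶜ m ≢ F → ⟦ c ⟧ᶜ m ≡ T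
  defined⇒clauseTrue m c def c≢F with any? (λ l → ⟦ l ⟧ˡ m ≟ᵛ T) c
  ... | yes _ = refl
  ... | no noneTrue with all? (λ l → ⟦ l ⟧ˡ m ≟ᵛ F) c
  ...   | yes _      = ⊥-elim (c≢F refl)
  ...   | no notAllF = ⊥-elim (notAllF (All.tabulate λ l∈c →
            ≢T∧≢U⇒≡F (λ l≡T → noneTrue (lose l∈c l≡T)) (All.lookup def l∈c)))

  clausesTrue⇒⊨ : ∀ m f → All (λ c → ⟦ c ⟧ᶜ m ≡ T) f → m ⊨ f
  clausesTrue⇒⊨ m f allTrue with all? (λ c → ⟦ c ⟧ᶜ m ≟ᵛ T) f
  ... | yes _      = refl
  ... | no notAllT = ⊥-elim (notAllT allTrue)

  final⇒literalDefined : ∀ {m f c l} → Final (m ∥ f) → c ∈ f → l ∈ c → ⟦ l ⟧ˡ m ≢ U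
  final⇒literalDefined final c∈f l∈c l≡U = final (_ , decide (inj₁ (lose c∈f l∈c)) l≡U)

  final⇒clauseNotFalse : ∀ {m f c} → Final (m ∥ f) → c ∈ f → ⟦ c ⟧ᶜ m ≢ F
  final⇒clauseNotFalse {m} {c = c} final c∈f c≡F with ∈⇒↭∷ c∈f | lastDecision m
  ... | _ , f↭ | inj₁ nd = final (_ , failure {c = c} f↭ c≡F nd)
  -- Matching `refl` replaces `m` by its split form, so that `final` and `c≡F` speak of exactly the
  -- assignment on which `backtrack` acts.
  ... | _ , f↭ | inj₂ (m′ , l , n , refl , nd) =
    final (_ , backtrack {m = m′} {c = c} f↭ c≡F nd)

theorem26 : {a : Level} {P : Set a} {k : ℕ} (P-finite : P ↔ Fin k) →
    let open DPLL P-finite in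
    (m : PartialAssignment) (f : Formula) →
    m WellFormedIn f → Final (m ∥ f) → m ⊨ f
theorem26 P-finite m f _ final = clausesTrue⇒⊨ P-finite m f (All.tabulate λ {c} c∈f →
  defined⇒clauseTrue P-finite m c
    (All.tabulate (final⇒literalDefined P-finite final c∈f))
    (final⇒clauseNotFalse P-finite final c∈f))
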